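{- Let $\mathscr C$ be a class of graphs of bounded expansion. Then $\mathscr C$ has bounded strong odd chromatic number, i.e., there exists $c\in\mathbb{N}$ such that every $G\in\mathscr C$ has strong odd chromatic number at most $c$.
   Context: All graphs are finite, simple and undirected. A proper coloring of $G$ is a map $\phi\colon V(G)\to C$ (finite palette $C$) with $\phi(u)\neq\phi(v)$ for every edge $uv$. A strong odd coloring of $G$ is a proper coloring $\phi$ such that for every vertex $u$ and every color $i\in C$, the number of neighbors of $u$ of color $i$ is either zero or odd. The strong odd chromatic number of $G$ is the minimum number of colors in a strong odd coloring of $G$. For $d\in\mathbb{N}$, a graph $H$ is a depth-$d$ minor of $G$ if one can assign to each $u\in V(H)$ a connected subgraph $\eta(u)$ of $G$ of radius at most $d$, the subgraphs $\eta(u)$ pairwise vertex-disjoint, such that for each edge $uv$ of $H$ there is an edge of $G$ between $\eta(u)$ and $\eta(v)$. $\nabla_d(G)$ is the maximum average degree of a depth-$d$ minor of $G$. A graph class $\mathscr C$ has bounded expansion if for every $d\in\mathbb{N}$ there is a constant bounding $\nabla_d(G)$ for all $G\in\mathscr C$. -}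

module Defs where

open import Data.Nat using (ℕ; zero; suc; _+_; _*_; _≤_)
open import Data.Fin using (Fin)
open import Data.Fin.Properties using () renaming (_≟_ to _≟ᶠ_)
open import Data.Bool using (Bool; true; false; _∧_)
open import Data.List using (List; map)
open import Data.Nat.ListAction using (sum)
open import Data.List.Base using () renaming (allFin to allFinL)
open import Data.Maybe using (Maybe; just; nothing)
open import Data.Product using (Σ; _×_; _,_; ∃; ∃-syntax)
open import Data.Sum using (_⊎_)
open import Relation.Nullary using (¬_)
open import Relation.Nullary.Decidable using (⌊_⌋)
open import Relation.Binary.PropositionalEquality using (_≡_; _≢_)

record Graph : Set where
  field
    n     : ℕ
    adj   : Fin n → Fin n → Bool
    sym   : ∀ u v → adj u v ≡ adj v u
    irr   : ∀ u → adj u u ≡ false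
open Graph public

count : (m : ℕ) → (Fin m → Bool) → ℕ
count m p = sum (map (λ i → if′ (p i)) (allFinL m))
  where
  if′ : Bool → ℕ
  if′ true = 1
  if′ false = 0

degree : (G : Graph) → Fin (n G) → ℕ
degree G u = count (n G) (adj G u)

degreeSum : Graph → ℕ
degreeSum G = sum (map (degree G) (allFinL (n G)))

AvgDegreeAtMost : ℕ → Graph → Set
AvgDegreeAtMost c G = degreeSum G ≤ c * n G

data Reach (G : Graph) (P : Fin (n G) → Set) : ℕ → Fin (n G) → Fin (n G) → Set where
  here : ∀ {k x} → P x → Reach G P k x x
  step : ∀ {k x y z} → P x → adj G x y ≡ true → Reach G P k y z → Reach G P (suc k) x z

-- A depth-d minor model of H in G.  The branch sets η(u) are encoded by a
-- partial map  branch : V(G) → Maybe V(H)  (η(u) = branch⁻¹(just u)),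
-- which makes them pairwise disjoint automatically.  Each η(u) has a centre
-- from which every vertex of η(u) is reachable inside η(u) in ≤ d steps
-- (so η(u) is nonempty, connected, of radius ≤ d).  Every edge of H is
-- realised by an edge of G between the corresponding branch sets.
record DepthMinorModel (d : ℕ) (H G : Graph) : Set where
  field
    branch : Fin (n G) → Maybe (Fin (n H))
    centre : Fin (n H) → Fin (n G)
    centre-in : ∀ u → branch (centre u) ≡ just u
    radius : ∀ u x → branch x ≡ just u →
             Reach G (λ y → branch y ≡ just u) d (centre u) x
    edges : ∀ u v → adj H u v ≡ true →
            ∃[ x ] ∃[ y ] (branch x ≡ just u × branch y ≡ just v × adj G x y ≡ true)

IsDepthMinor : ℕ → Graph → Graph → Set
IsDepthMinor d H G = DepthMinorModel d H G

NablaAtMost : ℕ → ℕ → Graph → Set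
NablaAtMost d c G = ∀ (H : Graph) → IsDepthMinor d H G → AvgDegreeAtMost c H

BoundedExpansion : (Graph → Set) → Set
BoundedExpansion 𝒞 = ∀ (d : ℕ) → ∃[ c ] (∀ G → 𝒞 G → NablaAtMost d c G)

Odd : ℕ → Set
Odd m = ∃[ k ] (m ≡ suc (2 * k))

colourCount : (G : Graph) {k : ℕ} → (Fin (n G) → Fin k) → Fin (n G) → Fin k → ℕ
colourCount G φ u i = count (n G) (λ v → adj G u v ∧ ⌊ φ v ≟ᶠ i ⌋)

IsProperColouring : (G : Graph) {k : ℕ} → (Fin (n G) → Fin k) → Set
IsProperColouring G φ = ∀ u v → adj G u v ≡ true → φ u ≢ φ v

IsStrongOddColouring : (G : Graph) {k : ℕ} → (Fin (n G) → Fin k) → Set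
IsStrongOddColouring G φ =
  IsProperColouring G φ ×
  (∀ u i → colourCount G φ u i ≡ 0 ⊎ Odd (colourCount G φ u i))

StrongOddChromaticAtMost : ℕ → Graph → Set
StrongOddChromaticAtMost c G = Σ (Fin (n G) → Fin c) (IsStrongOddColouring G)

{-# OPTIONS --safe #-}
-- Let c bound ∇₁(G).  Orient G along a degeneracy order, so that every vertex has at most c
-- parents, and call w, v fraternal if w is a parent of some u and v is another neighbour of u.
-- Contracting, for each colour i of a proper colouring λ₀ and each p, the vertices of colour i
-- into their p-th parents gives depth-1 minors covering all fraternal pairs, so fraternity is
-- degenerate too; fix a degeneracy order L and a proper colouring λ₁ for it.
-- A parent of u shares its λ₁-colour with no other neighbour of u.  For the children v of u,
-- list the parents of v in the order L: those following u are among the boundedly many later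
-- fraternal neighbours of u, so u and a bounded label of v determine that suffix of the list.
-- It remains to refine the labels, by one bit per suffix position, until every
-- (suffix, colour)-class is empty or odd: going from long to short suffixes, an even class is
-- repaired by recolouring one of the odd classes it consists of.
module Submission where

open import Defs
open import Data.Bool using (Bool; true; false; _∧_)
open import Data.Bool.Properties using () renaming (_≟_ to _≟ᵇ_)
open import Data.Fin using (Fin; zero; suc; combine; funToFin; finToFun; fromℕ<)
open import Data.Fin.Properties using (any?; pigeonhole; ¬∀⟶∃¬; combine-surjective; combine-injective; finToFun-funToFin; fromℕ<-injective) renaming (_≟_ to _≟ᶠ_; <⇒≢ to <⇒≢ᶠ)
open import Data.List using (List; []; _∷_; _++_; map; length; filter; lookup; allFin; drop)
import Data.List.Membership.DecPropositional as DecMembership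
open import Data.List.Membership.Propositional using (_∈_; _∉_; lose)
open import Data.List.Membership.Propositional.Properties using (∈-allFin; ∈-filter⁺; ∈-filter⁻; ∈-∃++; ∈-map⁺; ∈-lookup; ∈-++⁺ʳ)
open import Data.List.Properties using (tabulate-lookup; map-tabulate; length-filter; filter-some; filter-none; filter-accept; length-map; ≡-dec; drop-drop; take++drop≡id; ∷-injectiveˡ)
open import Data.List.Relation.Binary.Permutation.Propositional using (_↭_; ↭-sym; ↭-trans; prep; ↭⇒↭ₛ; ↭-refl)
open import Data.List.Relation.Binary.Permutation.Propositional.Properties using (shift; filter-↭; ↭-length; ∈-resp-↭)
import Data.List.Relation.Binary.Permutation.Setoid.Properties as Permₛ
open import Data.List.Relation.Unary.All as All using ([]; _∷_)
open import Data.List.Relation.Unary.AllPairs using ([]; _∷_)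
open import Data.List.Relation.Unary.Any as Any using (here; there)
open import Data.List.Relation.Unary.Any.Properties using (lookup-index)
open import Data.List.Relation.Unary.Unique.Propositional using (Unique)
open import Data.List.Relation.Unary.Unique.Propositional.Properties using (allFin⁺; Unique[x∷xs]⇒x∉xs; filter⁺)
open import Data.Maybe using (Maybe; just; nothing; fromMaybe)
open import Data.Maybe.Properties using (just-injective) renaming (≡-dec to ≡-decᵐ)
open import Data.Nat using (ℕ; zero; suc; _+_; _*_; _^_; _≤_; z≤n; s≤s; _≤?_)
open import Data.Nat.ListAction using (sum)
open import Data.Nat.Properties
open import Data.Product using (Σ; _×_; _,_; ∃-syntax; proj₁; proj₂)
open import Data.Sum using (_⊎_; inj₁; inj₂)
open import Function using (_∘_; id; mk⇔)
open import Relation.Binary.Definitions using (DecidableEquality)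
open import Relation.Binary.PropositionalEquality as ≡ using (_≡_; _≢_; refl; trans; cong; cong₂; subst)
open import Relation.Nullary using (¬_; Dec; yes; no; does; contradiction)
open import Relation.Nullary.Decidable using (⌊_⌋; _×-dec_; _⊎-dec_; ¬?; map′; dec-true; dec-false; does-⇔)
open import Relation.Unary using (Decidable)

private variable
  A B : Set

-- Counting and summing over lists.

cnt : {P : A → Set} → Decidable P → List A → ℕ
cnt P? xs = length (filter P? xs)

cnt-mono : {P Q : A → Set} (P? : Decidable P) (Q? : Decidable Q) (xs : List A) →
           (∀ {x} → x ∈ xs → P x → Q x) → cnt P? xs ≤ cnt Q? xs
cnt-mono P? Q? [] imp = z≤n
cnt-mono P? Q? (x ∷ xs) imp with P? x | Q? x
... | yes _ | yes _  = s≤s (cnt-mono P? Q? xs (imp ∘ there))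
... | yes p | no ¬q  = contradiction (imp (here refl) p) ¬q
... | no _  | yes _  = m≤n⇒m≤1+n (cnt-mono P? Q? xs (imp ∘ there))
... | no _  | no _   = cnt-mono P? Q? xs (imp ∘ there)

cnt-cong : {P Q : A → Set} (P? : Decidable P) (Q? : Decidable Q) (xs : List A) →
           (∀ {x} → P x → Q x) → (∀ {x} → Q x → P x) → cnt P? xs ≡ cnt Q? xs
cnt-cong P? Q? xs f g =
  ≤-antisym (cnt-mono P? Q? xs (λ _ → f)) (cnt-mono Q? P? xs (λ _ → g))

cnt-none : {P : A → Set} (P? : Decidable P) (xs : List A) → (∀ {x} → x ∈ xs → ¬ P x) → cnt P? xs ≡ 0
cnt-none P? xs ¬p = cong length (filter-none P? (All.tabulate ¬p))

cnt-⊎ : {P Q : A → Set} (P? : Decidable P) (Q? : Decidable Q) (xs : List A) →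
        cnt (λ x → P? x ⊎-dec Q? x) xs ≤ cnt P? xs + cnt Q? xs
cnt-⊎ P? Q? [] = z≤n
cnt-⊎ P? Q? (x ∷ xs) with P? x | Q? x
... | yes _ | yes _ = s≤s (≤-trans (cnt-⊎ P? Q? xs) (+-monoʳ-≤ (cnt P? xs) (n≤1+n _)))
... | yes _ | no _  = s≤s (cnt-⊎ P? Q? xs)
... | no _  | yes _ = ≤-trans (s≤s (cnt-⊎ P? Q? xs)) (≤-reflexive (≡.sym (+-suc _ _)))
... | no _  | no _  = cnt-⊎ P? Q? xs

cnt-split : {P Q : A → Set} (P? : Decidable P) (Q? : Decidable Q) (xs : List A) →
            cnt P? xs ≡ cnt (λ x → P? x ×-dec Q? x) xs + cnt (λ x → P? x ×-dec ¬? (Q? x)) xs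
cnt-split P? Q? [] = refl
cnt-split P? Q? (x ∷ xs) with P? x | Q? x
... | yes _ | yes _ = cong suc (cnt-split P? Q? xs)
... | yes _ | no _  = trans (cong suc (cnt-split P? Q? xs)) (≡.sym (+-suc _ _))
... | no _  | yes _ = cnt-split P? Q? xs
... | no _  | no _  = cnt-split P? Q? xs

cnt-map : {P : A → Set} (f : B → A) (P? : Decidable P) (xs : List B) →
          cnt (P? ∘ f) xs ≡ cnt P? (map f xs)
cnt-map f P? [] = refl
cnt-map f P? (x ∷ xs) with P? (f x)
... | yes _ = cong suc (cnt-map f P? xs)
... | no _  = cnt-map f P? xs

cnt-filter : {P Q : A → Set} (P? : Decidable P) (Q? : Decidable Q) (xs : List A) →
             (∀ {x} → P x → Q x) → cnt P? xs ≤ cnt P? (filter Q? xs)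
cnt-filter P? Q? [] imp = z≤n
cnt-filter P? Q? (x ∷ xs) imp with P? x in eq | Q? x
... | yes _ | yes _ rewrite eq = s≤s (cnt-filter P? Q? xs imp)
... | yes p | no ¬q = contradiction (imp p) ¬q
... | no _  | yes _ rewrite eq = cnt-filter P? Q? xs imp
... | no _  | no _  = cnt-filter P? Q? xs imp

sumOf : (A → ℕ) → List A → ℕ
sumOf f xs = sum (map f xs)

sumOf-mono : (f g : A → ℕ) (xs : List A) → (∀ x → f x ≤ g x) → sumOf f xs ≤ sumOf g xs
sumOf-mono f g [] h = z≤n
sumOf-mono f g (x ∷ xs) h = +-mono-≤ (h x) (sumOf-mono f g xs h)

sumOf-+ : (f g : A → ℕ) (xs : List A) → sumOf (λ x → f x + g x) xs ≡ sumOf f xs + sumOf g xs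
sumOf-+ f g [] = refl
sumOf-+ f g (x ∷ xs) rewrite sumOf-+ f g xs = begin
  (f x + g x) + (sumOf f xs + sumOf g xs) ≡⟨ +-assoc (f x) (g x) _ ⟩
  f x + (g x + (sumOf f xs + sumOf g xs)) ≡⟨ cong (f x +_) (+-assoc (g x) _ _) ⟨
  f x + ((g x + sumOf f xs) + sumOf g xs) ≡⟨ cong (λ z → f x + (z + sumOf g xs)) (+-comm (g x) _) ⟩
  f x + ((sumOf f xs + g x) + sumOf g xs) ≡⟨ cong (f x +_) (+-assoc (sumOf f xs) _ _) ⟩
  f x + (sumOf f xs + (g x + sumOf g xs)) ≡⟨ +-assoc (f x) _ _ ⟨
  (f x + sumOf f xs) + (g x + sumOf g xs) ∎
  where open ≡.≡-Reasoning

sumOf-zero : (f : A → ℕ) (xs : List A) → (∀ x → f x ≡ 0) → sumOf f xs ≡ 0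
sumOf-zero f [] h = refl
sumOf-zero f (x ∷ xs) h rewrite h x = sumOf-zero f xs h

sumOf-filter : {Q : A → Set} (f : A → ℕ) (Q? : Decidable Q) (xs : List A) →
               (∀ x → ¬ Q x → f x ≡ 0) → sumOf f xs ≡ sumOf f (filter Q? xs)
sumOf-filter f Q? [] h = refl
sumOf-filter f Q? (x ∷ xs) h with Q? x
... | yes _ = cong (f x +_) (sumOf-filter f Q? xs h)
... | no ¬q rewrite h x ¬q = sumOf-filter f Q? xs h

-- If the head exceeds `D`, discarding it removes more than its share of the sum, so the average of
-- the rest is still at most `D`.
exists-≤-average : ∀ D (f : A → ℕ) (x : A) (xs : List A) →
  sumOf f (x ∷ xs) ≤ D * length (x ∷ xs) → ∃[ y ] (y ∈ x ∷ xs × f y ≤ D)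
exists-≤-average D f x xs h with f x ≤? D
... | yes fx≤D = x , here refl , fx≤D
... | no fx≰D with xs
...   | [] = contradiction (≤-trans (m≤m+n (f x) 0) (≤-trans h (≤-reflexive (*-identityʳ D)))) fx≰D
...   | y ∷ ys with exists-≤-average D f y ys rest
  where
  rest : sumOf f (y ∷ ys) ≤ D * length (y ∷ ys)
  rest = +-cancelˡ-≤ D _ _ (≤-trans (+-monoˡ-≤ _ (<⇒≤ (≰⇒> fx≰D)))
           (≤-trans h (≤-reflexive (*-suc D (length (y ∷ ys))))))
...     | z , z∈ , fz≤D = z , there z∈ , fz≤D

-- The helper inside `count` has no name; the summand is recovered by unification.
countSummand : ∀ m (p : Fin m → Bool) → Σ (Fin m → ℕ) λ g → count m p ≡ sumOf g (allFin m)
countSummand m p = _ , refl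

count≡cnt : ∀ m {P : Fin m → Set} (p : Fin m → Bool) (P? : Decidable P) →
            (∀ i → p i ≡ true → P i) → (∀ i → P i → p i ≡ true) →
            count m p ≡ cnt P? (allFin m)
count≡cnt m p P? to from = go (allFin m)
  where
  g : Fin m → ℕ
  g = proj₁ (countSummand m p)

  go : ∀ xs → sumOf g xs ≡ cnt P? xs
  go [] = refl
  go (x ∷ xs) with p x in eq | P? x
  ... | true  | yes _ = cong suc (go xs)
  ... | true  | no ¬q = contradiction (to x eq) ¬q
  ... | false | yes q = contradiction (trans (≡.sym eq) (from x q)) λ ()
  ... | false | no _  = go xs

-- Together with `sumOf-lookup` this translates degrees in a graph whose vertices are the positions
-- of `xs` into counts over the entries of `xs`.
cnt-lookup : {P : A → Set} (P? : Decidable P) (xs : List A) →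
             cnt (P? ∘ lookup xs) (allFin (length xs)) ≡ cnt P? xs
cnt-lookup P? xs = trans (cnt-map (lookup xs) P? (allFin (length xs)))
  (cong (cnt P?) (trans (map-tabulate id (lookup xs)) (tabulate-lookup xs)))

sumOf-lookup : (f : A → ℕ) (xs : List A) → sumOf (f ∘ lookup xs) (allFin (length xs)) ≡ sumOf f xs
sumOf-lookup f xs = cong sum (trans (map-tabulate id (f ∘ lookup xs))
  (trans (≡.sym (map-tabulate (lookup xs) f)) (cong (map f) (tabulate-lookup xs))))

sumOf-cong : {f g : A → ℕ} (xs : List A) → (∀ x → f x ≡ g x) → sumOf f xs ≡ sumOf g xs
sumOf-cong [] h = refl
sumOf-cong (x ∷ xs) h = cong₂ _+_ (h x) (sumOf-cong xs h)

-- Duplicate-free lists, sparse relations and degeneracy orders.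

lookup-injective : {xs : List A} → Unique xs → ∀ {i j} → lookup xs i ≡ lookup xs j → i ≡ j
lookup-injective (_ ∷ _) {zero} {zero} eq = refl
lookup-injective (x∉ ∷ _) {zero} {suc j} eq = contradiction eq (All.lookup x∉ (∈-lookup j))
lookup-injective (x∉ ∷ _) {suc i} {zero} eq = contradiction (≡.sym eq) (All.lookup x∉ (∈-lookup i))
lookup-injective (_ ∷ u) {suc i} {suc j} eq = cong suc (lookup-injective u eq)

Unique-resp-↭ : {xs ys : List A} → xs ↭ ys → Unique xs → Unique ys
Unique-resp-↭ xs↭ys = Permₛ.Unique-resp-↭ (≡.setoid _) (↭⇒↭ₛ xs↭ys)

-- Average degree at most `D` in every induced subgraph, with vertex sets given as duplicate-free
-- lists. The condition is hereditary, which is what peeling off vertices requires, and it adds up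
-- under unions of relations.
record Sparse {N} (D : ℕ) {R : Fin N → Fin N → Set} (R? : ∀ u → Decidable (R u)) : Set where
  field
    degreeSum≤ : ∀ S → Unique S → sumOf (λ u → cnt (R? u) S) S ≤ D * length S
open Sparse

Sparse-mono : ∀ {N D} {R Q : Fin N → Fin N → Set} (R? : ∀ u → Decidable (R u)) (Q? : ∀ u → Decidable (Q u)) →
              (∀ {u v} → R u v → Q u v) → Sparse D Q? → Sparse D R?
Sparse-mono R? Q? imp sp .degreeSum≤ S uq =
  ≤-trans (sumOf-mono _ _ S (λ u → cnt-mono (R? u) (Q? u) S (λ _ → imp))) (sp .degreeSum≤ S uq)

Sparse-⊎ : ∀ {N D E} {R Q : Fin N → Fin N → Set} (R? : ∀ u → Decidable (R u)) (Q? : ∀ u → Decidable (Q u)) →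
           Sparse D R? → Sparse E Q? → Sparse (D + E) (λ u v → R? u v ⊎-dec Q? u v)
Sparse-⊎ {D = D} {E} R? Q? spR spQ .degreeSum≤ S uq = begin
  sumOf (λ u → cnt (λ v → R? u v ⊎-dec Q? u v) S) S
    ≤⟨ sumOf-mono _ _ S (λ u → cnt-⊎ (R? u) (Q? u) S) ⟩
  sumOf (λ u → cnt (R? u) S + cnt (Q? u) S) S
    ≡⟨ sumOf-+ (λ u → cnt (R? u) S) (λ u → cnt (Q? u) S) S ⟩
  sumOf (λ u → cnt (R? u) S) S + sumOf (λ u → cnt (Q? u) S) S
    ≤⟨ +-mono-≤ (spR .degreeSum≤ S uq) (spQ .degreeSum≤ S uq) ⟩
  D * length S + E * length S
    ≡⟨ *-distribʳ-+ (length S) D E ⟨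
  (D + E) * length S ∎
  where open ≤-Reasoning

Sparse-∃ : ∀ {N D} m {R : Fin m → Fin N → Fin N → Set} (R? : ∀ j u → Decidable (R j u)) →
           (∀ j → Sparse D (R? j)) → Sparse (m * D) (λ u v → any? (λ j → R? j u v))
Sparse-∃ zero R? sp .degreeSum≤ S uq =
  ≤-reflexive (sumOf-zero _ S (λ u → cnt-none (λ v → any? (λ j → R? j u v)) S λ { _ (() , _) }))
Sparse-∃ (suc m) R? sp =
  Sparse-mono (λ u v → any? (λ j → R? j u v)) (λ u v → R? zero u v ⊎-dec any? (λ j → R? (suc j) u v))
    (λ { (zero , r) → inj₁ r ; (suc j , r) → inj₂ (j , r) })
    (Sparse-⊎ (R? zero) _ (sp zero) (Sparse-∃ m (R? ∘ suc) (sp ∘ suc)))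

data Degenerate (D : ℕ) {R : A → A → Set} (R? : ∀ u → Decidable (R u)) : List A → Set where
  []  : Degenerate D R? []
  _∷_ : ∀ {u L} → cnt (R? u) L ≤ D → Degenerate D R? L → Degenerate D R? (u ∷ L)

-- Some vertex of the remaining set has at most average degree; it goes first and the rest is
-- ordered recursively.
degeneracyOrder : ∀ {N D} {R : Fin N → Fin N → Set} (R? : ∀ u → Decidable (R u)) → Sparse D R? →
  ∃[ L ] (L ↭ allFin N × Degenerate D R? L)
degeneracyOrder {N} {D} R? sp = peel (length (allFin N)) (allFin N) refl (allFin⁺ N)
  where
  peel : ∀ s S → length S ≡ s → Unique S → ∃[ L ] (L ↭ S × Degenerate D R? L)
  peel s [] eq uq = [] , ↭-refl , []
  peel (suc s) S@(x ∷ xs) eq uq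
    with exists-≤-average D (λ u → cnt (R? u) S) x xs (sp .degreeSum≤ S uq)
  ... | u , u∈S , few with ∈-∃++ u∈S
  ...   | ys , zs , S≡ with S↭ ← subst (_↭ u ∷ ys ++ zs) (≡.sym S≡) (shift u ys zs)
                      with _ ∷ uq′ ← Unique-resp-↭ S↭ uq
                      with peel s (ys ++ zs) (suc-injective (trans (≡.sym (↭-length S↭)) eq)) uq′
  ...     | L , L↭ , deg = u ∷ L , uL↭S , ≤-trans few′ few ∷ deg
    where
    uL↭S : u ∷ L ↭ S
    uL↭S = ↭-trans (prep u L↭) (↭-sym S↭)
    -- The degree of `u` was measured in `S`, which is a permutation of `u ∷ L`; omitting `u` itself
    -- can only lower the count.
    few′ : cnt (R? u) L ≤ cnt (R? u) S
    few′ = ≤-trans tail≤ (≤-reflexive (↭-length (filter-↭ (R? u) uL↭S)))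
      where
      tail≤ : cnt (R? u) L ≤ cnt (R? u) (u ∷ L)
      tail≤ with does (R? u u)
      ... | true  = n≤1+n _
      ... | false = ≤-refl

-- Greedy colouring along a degeneracy order.

freshColour : ∀ {D} (xs : List (Fin (suc D))) → length xs ≤ D → ∃[ c ] c ∉ xs
freshColour {D} xs len = ¬∀⟶∃¬ (suc D) (_∈ xs) (_∈? xs) λ all∈ →
  -- If all `suc D` colours occurred, two of them would share an index in a list of at most `D`
  -- entries.
  let i , j , i<j , eq = pigeonhole (s≤s len) (λ c → Any.index (all∈ c))
  in <⇒≢ᶠ i<j (trans (lookup-index (all∈ i)) (trans (cong (lookup xs) eq) (≡.sym (lookup-index (all∈ j)))))
  where open DecMembership _≟ᶠ_ using (_∈?_)

-- The tail is coloured first; the head then has at most `D` related vertices there and avoids their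
-- colours. Symmetry of `R` covers pairs whose second member is the head.
greedyColouring : ∀ {N D} {R : Fin N → Fin N → Set} (R? : ∀ u → Decidable (R u)) →
  (∀ {u v} → R u v → R v u) → ∀ {L} → Degenerate D R? L →
  Σ (Fin N → Fin (suc D)) λ φ → ∀ {u v} → u ∈ L → v ∈ L → u ≢ v → R u v → φ u ≢ φ v
greedyColouring R? R-sym [] = (λ _ → zero) , λ ()
greedyColouring {N} {D} {R} R? R-sym {u ∷ L} (few ∷ deg)
  with greedyColouring R? R-sym deg
... | φ , proper with freshColour (map φ (filter (R? u) L))
                        (≤-trans (≤-reflexive (length-map φ (filter (R? u) L))) few)
...   | c , fresh = φ′ , proper′
  where
  φ′ : Fin N → Fin (suc D)
  φ′ v with v ≟ᶠ u
  ... | yes _ = c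
  ... | no _  = φ v

  strip : ∀ {v} → v ≢ u → v ∈ u ∷ L → v ∈ L
  strip v≢u (here v≡u) = contradiction v≡u v≢u
  strip v≢u (there v∈) = v∈

  avoids : ∀ {v} → v ∈ L → R u v → c ≢ φ v
  avoids v∈ r refl = fresh (∈-map⁺ φ (∈-filter⁺ (R? u) v∈ r))

  proper′ : ∀ {v w} → v ∈ u ∷ L → w ∈ u ∷ L → v ≢ w → R v w → φ′ v ≢ φ′ w
  proper′ {v} {w} v∈ w∈ v≢w r with v ≟ᶠ u | w ≟ᶠ u
  ... | yes refl | yes refl = contradiction refl v≢w
  ... | yes refl | no w≢u   = avoids (strip w≢u w∈) r
  ... | no v≢u   | yes refl = ≡.≢-sym (avoids (strip v≢u v∈) (R-sym r))
  ... | no v≢u   | no w≢u   = proper (strip v≢u v∈) (strip w≢u w∈) v≢w r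

record Layout {N} (D : ℕ) {R : Fin N → Fin N → Set} (R? : ∀ u → Decidable (R u)) : Set where
  field
    order         : List (Fin N)
    unique        : Unique order
    exhaustive    : ∀ u → u ∈ order
    degenerate    : Degenerate D R? order
    colour        : Fin N → Fin (suc D)
    colour-proper : ∀ {u v} → u ≢ v → R u v → colour u ≢ colour v

layout : ∀ {N D} {R : Fin N → Fin N → Set} (R? : ∀ u → Decidable (R u)) → (∀ {u v} → R u v → R v u) →
         Sparse D R? → Layout D R?
layout {N} R? R-sym sp with degeneracyOrder R? sp
... | L , L↭ , deg with greedyColouring R? R-sym deg
...   | φ , proper = record
  { order         = L
  ; unique        = Unique-resp-↭ (↭-sym L↭) (allFin⁺ N)
  ; exhaustive    = L∋
  ; degenerate    = deg
  ; colour        = φ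
  ; colour-proper = λ {u} {v} → proper (L∋ u) (L∋ v)
  }
  where
  L∋ : ∀ u → u ∈ L
  L∋ u = ∈-resp-↭ (↭-sym L↭) (∈-allFin u)

-- Positions in a vertex order.

after : ∀ {N} → List (Fin N) → Fin N → List (Fin N)
after [] u = []
after (x ∷ xs) u with x ≟ᶠ u
... | yes _ = xs
... | no _  = after xs u

after-⊆ : ∀ {N} (L : List (Fin N)) u {v} → v ∈ after L u → v ∈ L
after-⊆ (x ∷ xs) u v∈ with x ≟ᶠ u
... | yes _ = there v∈
... | no _  = there (after-⊆ xs u v∈)

after-irrefl : ∀ {N} {L : List (Fin N)} → Unique L → ∀ u → u ∉ after L u
after-irrefl {L = x ∷ xs} (x∉ ∷ uq) u u∈ with x ≟ᶠ u
... | yes refl = All.lookup x∉ u∈ refl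
... | no _     = after-irrefl uq u u∈

after-total : ∀ {N} (L : List (Fin N)) {u v} → u ≢ v → u ∈ L → v ∈ L → v ∈ after L u ⊎ u ∈ after L v
after-total (x ∷ xs) {u} {v} u≢v u∈ v∈ with x ≟ᶠ u | x ≟ᶠ v
after-total (x ∷ xs) u≢v u∈ v∈ | yes refl | yes refl = contradiction refl u≢v
after-total (x ∷ xs) u≢v u∈ (here refl) | yes refl | no x≢v = contradiction refl x≢v
after-total (x ∷ xs) u≢v u∈ (there v∈) | yes refl | no _ = inj₁ v∈
after-total (x ∷ xs) u≢v (here refl) v∈ | no x≢u | yes refl = contradiction refl x≢u
after-total (x ∷ xs) u≢v (there u∈) v∈ | no _ | yes refl = inj₂ u∈
after-total (x ∷ xs) u≢v (here refl) v∈ | no x≢u | no _ = contradiction refl x≢u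
after-total (x ∷ xs) u≢v (there u∈) (here refl) | no _ | no x≢v = contradiction refl x≢v
after-total (x ∷ xs) u≢v (there u∈) (there v∈) | no _ | no _ = after-total xs u≢v u∈ v∈

-- The out-neighbours of `u` when related pairs are oriented towards the later vertex of `L`. Both
-- `parents` and `later` are instances.
out : ∀ {N} {R : Fin N → Fin N → Set} → (∀ u → Decidable (R u)) → List (Fin N) → Fin N → List (Fin N)
out R? L u = filter (R? u) (after L u)

length-out : ∀ {N D} {R : Fin N → Fin N → Set} (R? : ∀ u → Decidable (R u)) {L} →
             Degenerate D R? L → ∀ u → length (out R? L u) ≤ D
length-out R? [] u = z≤n
length-out R? (_∷_ {x} few deg) u with x ≟ᶠ u
... | yes refl = few
... | no _     = length-out R? deg u

-- The witness `t` counts the entries satisfying `P` before `u`. This locates a parent inside an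
-- `ancestry`.
filter-from : ∀ {N} {P : Fin N → Set} (P? : Decidable P) {u} → P u → ∀ L → u ∈ L →
  ∃[ t ] (drop t (filter P? L) ≡ u ∷ filter P? (after L u))
filter-from P? {u} pu (x ∷ xs) u∈ with x ≟ᶠ u
... | yes refl = 0 , filter-accept P? pu
filter-from P? {u} pu (x ∷ xs) (here refl) | no x≢u = contradiction refl x≢u
filter-from P? {u} pu (x ∷ xs) (there u∈) | no _ with filter-from P? pu xs u∈ | does (P? x)
... | t , eq | true  = suc t , eq
... | t , eq | false = t , eq

-- The first member of the clique is related to all the others, which come after it, so there are at
-- most `D` others.
length-filter-clique : ∀ {D} {R : A → A → Set} (R? : ∀ u → Decidable (R u)) {P : A → Set} (P? : Decidable P) →
  (∀ {u v} → P u → P v → u ≢ v → R u v) →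
  ∀ {L} → Unique L → Degenerate D R? L → length (filter P? L) ≤ suc D
length-filter-clique R? P? clique {[]} uq deg = z≤n
length-filter-clique R? P? clique {x ∷ L} (x∉ ∷ uq) (few ∷ deg) with P? x
... | yes px = s≤s (≤-trans (cnt-mono P? (R? x) L (λ y∈ py → clique px py (All.lookup x∉ y∈))) few)
... | no _   = length-filter-clique R? P? clique uq deg

-- The index range `k` is independent of the list, so that one index `p` can stand for the `p`-th
-- entry of many lists of different lengths.
nth : ∀ {k} → List A → Fin k → Maybe A
nth [] _ = nothing
nth (x ∷ xs) zero = just x
nth (x ∷ xs) (suc p) = nth xs p

∈⇒nth : ∀ {k} {xs : List A} {x} → length xs ≤ k → x ∈ xs → Σ (Fin k) λ p → nth xs p ≡ just x
∈⇒nth (s≤s len) (here refl) = zero , refl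
∈⇒nth (s≤s len) (there x∈) = let p , eq = ∈⇒nth len x∈ in suc p , eq

nth⇒∈ : ∀ {k} (xs : List A) (p : Fin k) {x} → nth xs p ≡ just x → x ∈ xs
nth⇒∈ (x ∷ xs) zero refl = here refl
nth⇒∈ (x ∷ xs) (suc p) eq = there (nth⇒∈ xs p eq)

-- Contractions into stars as depth-1 minors.

does-true⇒ : (a? : Dec A) → does a? ≡ true → A
does-true⇒ (yes a) _ = a

-- Adjacency after contracting every `x` into `root x`. Only fixed points of `root` count as
-- vertices of the contracted graph; all others are isolated.
record Contracted (G : Graph) (root : Fin (n G) → Fin (n G)) (u v : Fin (n G)) : Set where
  constructor contracted
  field
    distinct : u ≢ v
    rootˡ    : root u ≡ u
    rootʳ    : root v ≡ v
    linked   : ∃[ x ] ∃[ y ] (root x ≡ u × root y ≡ v × adj G x y ≡ true)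

contracted? : ∀ G root u → Decidable (Contracted G root u)
contracted? G root u v = map′
  (λ { (d , r , r′ , l) → contracted d r r′ l }) (λ { (contracted d r r′ l) → d , r , r′ , l })
  (¬? (u ≟ᶠ v) ×-dec root u ≟ᶠ u ×-dec root v ≟ᶠ v ×-dec
   any? λ x → any? λ y → root x ≟ᶠ u ×-dec root y ≟ᶠ v ×-dec adj G x y ≟ᵇ true)

Contracted-sym : ∀ G {root u v} → Contracted G root u v → Contracted G root v u
Contracted-sym G (contracted d r r′ (x , y , rx , ry , xy)) =
  contracted (≡.≢-sym d) r′ r (y , x , ry , rx , trans (Graph.sym G y x) xy)

module _ (G : Graph) (root : Fin (n G) → Fin (n G))
         (root-near : ∀ x → root x ≡ x ⊎ adj G (root x) x ≡ true) where

  private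
    V = Fin (n G)

  module _ (S : List V) (uq : Unique S) (fixed : ∀ {u} → u ∈ S → root u ≡ u) where

    minor : Graph
    minor .n = length S
    minor .adj i j = does (contracted? G root (lookup S i) (lookup S j))
    minor .Graph.sym i j = does-⇔ (mk⇔ (Contracted-sym G) (Contracted-sym G))
      (contracted? G root (lookup S i) (lookup S j)) (contracted? G root (lookup S j) (lookup S i))
    minor .irr i = dec-false (contracted? G root (lookup S i) (lookup S i)) λ r → Contracted.distinct r refl

    adj⇒Contracted : ∀ i j → adj minor i j ≡ true → Contracted G root (lookup S i) (lookup S j)
    adj⇒Contracted i j = does-true⇒ (contracted? G root (lookup S i) (lookup S j))

    branchOf : V → Maybe (Fin (length S))
    branchOf x with any? (λ i → lookup S i ≟ᶠ root x)
    ... | yes (i , _) = just i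
    ... | no _        = nothing

    branchOf-complete : ∀ {x i} → root x ≡ lookup S i → branchOf x ≡ just i
    branchOf-complete {x} {i} eq with any? (λ i → lookup S i ≟ᶠ root x)
    ... | yes (j , eq′) = cong just (lookup-injective uq (trans eq′ eq))
    ... | no ¬∃         = contradiction (i , ≡.sym eq) ¬∃

    branchOf-sound : ∀ {x i} → branchOf x ≡ just i → lookup S i ≡ root x
    branchOf-sound {x} eq with any? (λ i → lookup S i ≟ᶠ root x)
    branchOf-sound refl | yes (_ , eq) = eq

    -- By `root-near`, the fibre of `root` over a fixed vertex is that vertex together with some of
    -- its neighbours: a star, of radius at most 1.
    isDepth1Minor : IsDepthMinor 1 minor G
    isDepth1Minor = record
      { branch = branchOf
      ; centre = lookup S
      ; centre-in = centre∈
      ; radius = λ u x bx → reach (branchOf-sound bx) bx (root-near x)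
      ; edges = λ u v uv →
          let contracted _ _ _ (x , y , rx , ry , xy) = adj⇒Contracted u v uv
          in x , y , branchOf-complete rx , branchOf-complete ry , xy
      }
      where
      centre∈ : ∀ u → branchOf (lookup S u) ≡ just u
      centre∈ u = branchOf-complete (fixed (∈-lookup u))

      reach : ∀ {u x} → lookup S u ≡ root x → branchOf x ≡ just u → root x ≡ x ⊎ adj G (root x) x ≡ true →
              Reach G (λ y → branchOf y ≡ just u) 1 (lookup S u) x
      reach eq bx (inj₁ rx≡x) rewrite trans eq rx≡x = here bx
      reach {u} {x} eq bx (inj₂ rx~x) =
        step (centre∈ u) (subst (λ c → adj G c x ≡ true) (≡.sym eq) rx~x) (here bx)

    degreeSum-minor : degreeSum minor ≡ sumOf (λ u → cnt (contracted? G root u) S) S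
    degreeSum-minor = trans
      (sumOf-cong (allFin (length S)) λ i →
        trans (count≡cnt (length S) (adj minor i) (contracted? G root (lookup S i) ∘ lookup S)
                 (adj⇒Contracted i) (λ j → dec-true (contracted? G root (lookup S i) (lookup S j))))
              (cnt-lookup (contracted? G root (lookup S i)) S))
      (sumOf-lookup (λ u → cnt (contracted? G root u) S) S)

  -- Entries of `S` not fixed by `root` contribute nothing to either side of a related pair.
  -- Dropping them leaves the degree sum of a depth-1 minor on at most `length S` vertices.
  contracted-sparse : ∀ {c} → NablaAtMost 1 c G → Sparse c (contracted? G root)
  contracted-sparse {c} nabla .degreeSum≤ S uq = begin
    sumOf (λ u → cnt (contracted? G root u) S) S
      ≤⟨ sumOf-mono _ _ S (λ u → cnt-filter (contracted? G root u) fixed? S Contracted.rootʳ) ⟩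
    sumOf (λ u → cnt (contracted? G root u) S′) S
      ≡⟨ sumOf-filter _ fixed? S (λ u ¬fix →
            cnt-none (contracted? G root u) S′ λ _ r → ¬fix (Contracted.rootˡ r)) ⟩
    sumOf (λ u → cnt (contracted? G root u) S′) S′
      ≡⟨ degreeSum-minor S′ uq′ fixed ⟨
    degreeSum (minor S′ uq′ fixed)
      ≤⟨ nabla (minor S′ uq′ fixed) (isDepth1Minor S′ uq′ fixed) ⟩
    c * length S′
      ≤⟨ *-monoʳ-≤ c (length-filter fixed? S) ⟩
    c * length S ∎
    where
    open ≤-Reasoning
    fixed? : Decidable (λ u → root u ≡ u)
    fixed? u = root u ≟ᶠ u
    S′ = filter fixed? S
    uq′ = filter⁺ fixed? uq
    fixed : ∀ {u} → u ∈ S′ → root u ≡ u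
    fixed u∈ = proj₂ (∈-filter⁻ fixed? {xs = S} u∈)

-- Singletons, suffixes, bits and parity.

cnt-some : {P : A → Set} (P? : Decidable P) {xs : List A} {x : A} → x ∈ xs → P x → cnt P? xs ≢ 0
cnt-some P? x∈ px eq = <⇒≢ (filter-some P? (lose x∈ px)) (≡.sym eq)

cnt-unique : {P : A → Set} (P? : Decidable P) {xs : List A} {x : A} → Unique xs → x ∈ xs →
             P x → (∀ {y} → P y → y ≡ x) → cnt P? xs ≡ 1
cnt-unique P? {y ∷ ys} {x} uq@(_ ∷ uq′) x∈ px only with P? y
... | yes py with refl ← only py =
  cong suc (cnt-none P? ys λ z∈ pz → Unique[x∷xs]⇒x∉xs uq (subst (_∈ ys) (only pz) z∈))
cnt-unique P? (_ ∷ uq) (here refl) px only | no ¬py = contradiction px ¬py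
cnt-unique P? (_ ∷ uq) (there x∈) px only  | no _   = cnt-unique P? uq x∈ px only

filter-cong-∈ : {P Q : A → Set} (P? : Decidable P) (Q? : Decidable Q) (xs : List A) →
                (∀ {x} → x ∈ xs → P x → Q x) → (∀ {x} → x ∈ xs → Q x → P x) → filter P? xs ≡ filter Q? xs
filter-cong-∈ P? Q? [] f g = refl
filter-cong-∈ P? Q? (x ∷ xs) f g with ih ← filter-cong-∈ P? Q? xs (f ∘ there) (g ∘ there) | P? x | Q? x
... | yes _ | yes _ = cong (x ∷_) ih
... | yes p | no ¬q = contradiction (f (here refl) p) ¬q
... | no ¬p | yes q = contradiction (g (here refl) q) ¬p
... | no _  | no _  = ih

length-drop-∷ : ∀ t (xs : List A) {y ys} → drop t xs ≡ y ∷ ys → length xs ≡ t + suc (length ys)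
length-drop-∷ zero xs refl = refl
length-drop-∷ (suc t) (x ∷ xs) eq = cong suc (length-drop-∷ t xs eq)

∈-drop⁻ : ∀ t (xs : List A) {x} → x ∈ drop t xs → x ∈ xs
∈-drop⁻ t xs x∈ = subst (_ ∈_) (take++drop≡id t xs) (∈-++⁺ʳ _ x∈)

funToFin-injective : ∀ {m k} (f g : Fin m → Fin k) → funToFin f ≡ funToFin g → ∀ i → f i ≡ g i
funToFin-injective f g eq i =
  trans (≡.sym (finToFun-funToFin f i)) (trans (cong (λ z → finToFun z i) eq) (finToFun-funToFin g i))

bit : Dec A → Fin 2
bit (yes _) = suc zero
bit (no _)  = zero

bit-one⁺ : (a? : Dec A) → A → bit a? ≡ suc zero
bit-one⁺ (yes _) a = refl
bit-one⁺ (no ¬a) a = contradiction a ¬a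

bit-one⁻ : (a? : Dec A) → bit a? ≡ suc zero → A
bit-one⁻ (yes a) _ = a

bit-zero⁺ : (a? : Dec A) → ¬ A → bit a? ≡ zero
bit-zero⁺ (yes a) ¬a = contradiction a ¬a
bit-zero⁺ (no _) ¬a = refl

bit-zero⁻ : (a? : Dec A) → bit a? ≡ zero → ¬ A
bit-zero⁻ (no ¬a) _ = ¬a

ZeroOrOdd : ℕ → Set
ZeroOrOdd m = m ≡ 0 ⊎ Odd m

even⊎odd : ∀ m → (∃[ k ] m ≡ 2 * k) ⊎ Odd m
even⊎odd zero = inj₁ (0 , refl)
even⊎odd (suc m) with even⊎odd m
... | inj₁ (k , refl) = inj₂ (k , refl)
... | inj₂ (k , refl) = inj₁ (suc k , cong suc (≡.sym (+-suc k (k + 0))))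

odd-complement : ∀ {m x y} → (∃[ k ] m ≡ 2 * k) → m ≡ x + y → Odd x → Odd y
odd-complement {y = y} (k , refl) eq (j , refl) with even⊎odd y
... | inj₂ odd = odd
... | inj₁ (l , refl) = contradiction (trans eq (cong suc (≡.sym (*-distribˡ-+ 2 j l)))) (even≢odd k (j + l))

-- Refining a colouring until its classes are empty or odd.

refinedColours : ℕ → ℕ → ℕ
refinedColours c zero    = c
refinedColours c (suc m) = refinedColours c m * 2

module Refinement {N : ℕ} {K : Set} (_≟_ : DecidableEquality K) where

  private
    V  = Fin N
    vs = allFin N

  class? : ∀ {c} (κ : V → K) (χ : V → Fin c) k i → Decidable (λ v → κ v ≡ k × χ v ≡ i)
  class? κ χ k i v = κ v ≟ k ×-dec χ v ≟ᶠ i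

  OddClasses : ∀ {c} → (V → K) → (V → Fin c) → Set
  OddClasses κ χ = ∀ k i → ZeroOrOdd (cnt (class? κ χ k i) vs)

  _Determines_ : (V → A) → (V → B) → Set
  κ Determines κ′ = ∀ {v w} → κ v ≡ κ w → κ′ v ≡ κ′ w

  injective⇒OddClasses : ∀ {c} (κ : V → K) (χ : V → Fin c) → (∀ {v w} → κ v ≡ κ w → v ≡ w) → OddClasses κ χ
  injective⇒OddClasses κ χ inj k i with any? (class? κ χ k i)
  ... | no ¬∃ = inj₁ (cnt-none (class? κ χ k i) vs λ _ p → ¬∃ (_ , p))
  ... | yes (v , κv , χv) = inj₂ (0 , cnt-unique (class? κ χ k i) (allFin⁺ N) (∈-allFin v) (κv , χv)
                                       λ (κw , _) → inj (trans κw (≡.sym κv)))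

  module _ {c} (κ κ′ : V → K) (det : κ Determines κ′) (χ : V → Fin c) (odd : OddClasses κ χ) where

    -- From a coarse class of even size one fine class, which is odd, is split off.
    splitting : ∀ k i → Σ (K → Fin 2) λ g →
      ∀ b → ZeroOrOdd (cnt (λ v → class? κ′ χ k i v ×-dec g (κ v) ≟ᶠ b) vs)
    splitting k i with even⊎odd (cnt (class? κ′ χ k i) vs) | any? (class? κ′ χ k i)
    ... | _ | no ¬∃ = (λ _ → zero) , λ b →
      inj₁ (cnt-none (λ v → class? κ′ χ k i v ×-dec zero ≟ᶠ b) vs λ _ (p , _) → ¬∃ (_ , p))
    ... | inj₂ o | yes _ = (λ _ → zero) , λ
      { zero → inj₂ (subst Odd (cnt-cong (class? κ′ χ k i) (λ v → class? κ′ χ k i v ×-dec zero ≟ᶠ zero) vs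
                                (_, refl) proj₁) o)
      ; (suc zero) → inj₁ (cnt-none (λ v → class? κ′ χ k i v ×-dec zero ≟ᶠ suc zero) vs λ { _ (_ , ()) }) }
    ... | inj₁ even | yes (w , κw , χw) = g , λ
      { zero → inj₂ (subst Odd (cnt-cong (λ v → class? κ′ χ k i v ×-dec ¬? (κ v ≟ κ w))
                  (λ v → class? κ′ χ k i v ×-dec g (κ v) ≟ᶠ zero) vs
                  (λ {v} (p , ¬q) → p , bit-zero⁺ (κ v ≟ κ w) ¬q)
                  (λ {v} (p , q) → p , bit-zero⁻ (κ v ≟ κ w) q)) oddRest)
      ; (suc zero) → inj₂ (subst Odd (cnt-cong chosen? (λ v → class? κ′ χ k i v ×-dec g (κ v) ≟ᶠ suc zero) vs
                  (λ {v} (p , q) → p , bit-one⁺ (κ v ≟ κ w) q)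
                  (λ {v} (p , q) → p , bit-one⁻ (κ v ≟ κ w) q)) oddChosen) }
      where
      g : K → Fin 2
      g k = bit (k ≟ κ w)

      chosen? : Decidable (λ v → (κ′ v ≡ k × χ v ≡ i) × κ v ≡ κ w)
      chosen? v = class? κ′ χ k i v ×-dec κ v ≟ κ w

      oddChosen : Odd (cnt chosen? vs)
      -- The fine class of `w` lies within the coarse class because `κ` determines `κ′`; it contains
      -- `w`, so it is odd rather than empty.
      oddChosen with odd (κ w) i
      ... | inj₁ none = contradiction none (cnt-some (class? κ χ (κ w) i) (∈-allFin w) (refl , χw))
      ... | inj₂ o = subst Odd (cnt-cong (class? κ χ (κ w) i) chosen? vs
                       (λ (q , r) → (trans (det q) κw , r) , q) (λ ((_ , r) , q) → q , r)) o

      oddRest : Odd (cnt (λ v → class? κ′ χ k i v ×-dec ¬? (κ v ≟ κ w)) vs)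
      oddRest = odd-complement even (cnt-split (class? κ′ χ k i) (λ v → κ v ≟ κ w) vs) oddChosen

    mark : V → Fin 2
    mark v = proj₁ (splitting (κ′ v) (χ v)) (κ v)

    marked : V → Fin (c * 2)
    marked v = combine (χ v) (mark v)

    marked-injective : ∀ {v w} → marked v ≡ marked w → χ v ≡ χ w × mark v ≡ mark w
    marked-injective {v} {w} = combine-injective (χ v) (mark v) (χ w) (mark w)

    -- A class of the new colouring is one of the two sides of a `splitting`.
    marked-coarse : OddClasses κ′ marked
    marked-coarse k i with combine-surjective {c} {2} i
    ... | j , b , refl = subst ZeroOrOdd
      (cnt-cong (λ v → class? κ′ χ k j v ×-dec proj₁ (splitting k j) (κ v) ≟ᶠ b)
        (class? κ′ marked k (combine j b)) vs
        (λ { ((refl , refl) , refl) → refl , refl })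
        (λ {v} (κv , eq) → case-eq κv (combine-injective (χ v) (mark v) j b eq)))
      (proj₂ (splitting k j) b)
      where
      case-eq : ∀ {v} → κ′ v ≡ k → χ v ≡ j × mark v ≡ b →
                (κ′ v ≡ k × χ v ≡ j) × proj₁ (splitting k j) (κ v) ≡ b
      case-eq refl (refl , refl) = (refl , refl) , refl

    -- The mark depends only on `κ` and `χ`, so it is constant on every class of the finer key `κ″`:
    -- such classes are never divided, and earlier repairs survive.
    marked-fine : ∀ κ″ → κ″ Determines κ → OddClasses κ″ χ → OddClasses κ″ marked
    marked-fine κ″ det″ odd″ k i with any? (class? κ″ marked k i)
    ... | no ¬∃ = inj₁ (cnt-none (class? κ″ marked k i) vs λ _ p → ¬∃ (_ , p))
    ... | yes (v , refl , refl) = subst ZeroOrOdd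
      (cnt-cong (class? κ″ χ (κ″ v) (χ v)) (class? κ″ marked (κ″ v) (marked v)) vs
        (λ (κw , χw) → κw , cong₂ combine χw (mark-cong (det″ κw) χw))
        (λ (κw , eq) → κw , proj₁ (marked-injective eq)))
      (odd″ (κ″ v) (χ v))
      where
      mark-cong : ∀ {v w} → κ w ≡ κ v → χ w ≡ χ v → mark w ≡ mark v
      mark-cong κw χw = trans (cong₂ (λ k i → proj₁ (splitting k i) _) (det κw) χw)
                              (cong (proj₁ (splitting _ _)) κw)

  module _ (κ : ℕ → V → K) (κ-injective : ∀ {v w} → κ 0 v ≡ κ 0 w → v ≡ w)
           (det : ∀ t → κ t Determines κ (suc t)) where

    det-≤ : ∀ {t} m → t ≤ m → κ t Determines κ m
    det-≤ m t≤m eq with m≤n⇒m<n∨m≡n t≤m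
    det-≤ (suc m) _ eq | inj₁ (s≤s t≤m) = det m (det-≤ m t≤m eq)
    det-≤ m _ eq       | inj₂ refl      = eq

    -- The keys become coarser as `t` grows. For the injective `κ 0` every class has at most one
    -- vertex; each round then repairs the next key by one bit, without dividing the classes of the
    -- previous keys.
    refinement : ∀ m {c} (χ : V → Fin c) → Σ (V → Fin (refinedColours c m)) λ χ′ →
                 χ′ Determines χ × (∀ t → t ≤ m → OddClasses (κ t) χ′)
    refinement zero χ = χ , id , λ { zero z≤n → injective⇒OddClasses (κ 0) χ κ-injective }
    refinement (suc m) {c} χ with refinement m χ
    ... | χ₁ , χ₁-det , odd =
      marked′ , χ₁-det ∘ proj₁ ∘ marked-injective (κ m) (κ (suc m)) (det m) χ₁ (odd m ≤-refl) , odd′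
      where
      marked′ : V → Fin (refinedColours c (suc m))
      marked′ = marked (κ m) (κ (suc m)) (det m) χ₁ (odd m ≤-refl)
      odd′ : ∀ t → t ≤ suc m → OddClasses (κ t) marked′
      odd′ t t≤ with m≤n⇒m<n∨m≡n t≤
      ... | inj₁ (s≤s t≤m) =
        marked-fine (κ m) (κ (suc m)) (det m) χ₁ (odd m ≤-refl) (κ t) (det-≤ m t≤m) (odd t t≤m)
      ... | inj₂ refl      = marked-coarse (κ m) (κ (suc m)) (det m) χ₁ (odd m ≤-refl)

-- Adjacency, parents and fraternal pairs.

module _ (G : Graph) where

  private
    V = Fin (n G)

  Adj : V → V → Set
  Adj u v = adj G u v ≡ true

  Adj? : ∀ u → Decidable (Adj u)
  Adj? u v = adj G u v ≟ᵇ true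

  Adj-sym : ∀ {u v} → Adj u v → Adj v u
  Adj-sym {u} {v} uv = trans (Graph.sym G v u) uv

  Adj⇒≢ : ∀ {u v} → Adj u v → u ≢ v
  Adj⇒≢ {u} uv refl with () ← trans (≡.sym uv) (irr G u)

  Adj-sparse : ∀ {c} → NablaAtMost 1 c G → Sparse c Adj?
  -- Contracting along the identity presents `G` itself as a contraction.
  Adj-sparse nabla = Sparse-mono Adj? (contracted? G id)
    (λ uv → contracted (Adj⇒≢ uv) refl refl (_ , _ , refl , refl , uv))
    (contracted-sparse G id (λ _ → inj₁ refl) nabla)

module Parents (G : Graph) {c : ℕ} (layout₀ : Layout c (Adj? G)) where

  open Layout layout₀ renaming
    (order to L₀; exhaustive to ∈L₀; degenerate to deg₀; colour to λ₀; colour-proper to λ₀-separates)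

  private
    V = Fin (n G)

  λ₀-proper : ∀ {u v} → Adj G u v → λ₀ u ≢ λ₀ v
  λ₀-proper uv = λ₀-separates (Adj⇒≢ G uv) uv

  parents : V → List V
  parents = out (Adj? G) L₀

  parent⇒Adj : ∀ {u w} → w ∈ parents u → Adj G u w
  parent⇒Adj {u} w∈ = proj₂ (∈-filter⁻ (Adj? G u) {xs = after L₀ u} w∈)

  Adj⇒parent : ∀ {u v} → Adj G u v → v ∈ parents u ⊎ u ∈ parents v
  Adj⇒parent {u} {v} uv with after-total L₀ (Adj⇒≢ G uv) (∈L₀ u) (∈L₀ v)
  ... | inj₁ v∈ = inj₁ (∈-filter⁺ (Adj? G u) v∈ uv)
  ... | inj₂ u∈ = inj₂ (∈-filter⁺ (Adj? G v) u∈ (Adj-sym G uv))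

  -- Only vertices of colour `i` move. Their parents have other colours since `λ₀` is proper, so the
  -- targets stay fixed. A vertex without a `p`-th parent stays in place.
  root : Fin (suc c) → Fin c → V → V
  root i p x with λ₀ x ≟ᶠ i
  ... | yes _ = fromMaybe x (nth (parents x) p)
  ... | no _  = x

  root-near : ∀ i p x → root i p x ≡ x ⊎ Adj G (root i p x) x
  root-near i p x with λ₀ x ≟ᶠ i
  ... | no _  = inj₁ refl
  ... | yes _ with nth (parents x) p in eq
  ...   | nothing = inj₁ refl
  ...   | just w  = inj₂ (Adj-sym G (parent⇒Adj (nth⇒∈ (parents x) p eq)))

  root-fixed : ∀ {i} p {x} → λ₀ x ≢ i → root i p x ≡ x
  root-fixed {i} p {x} x≢i with λ₀ x ≟ᶠ i
  ... | yes x≡i = contradiction x≡i x≢i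
  ... | no _    = refl

  root-parent : ∀ {p x w} → nth (parents x) p ≡ just w → root (λ₀ x) p x ≡ w
  root-parent {p} {x} eq with λ₀ x ≟ᶠ λ₀ x
  ... | yes _ rewrite eq = refl
  ... | no ≢            = contradiction refl ≢

  -- Defined through the contractions, so that sparsity is inherited from depth-1 minors;
  -- `parent-fraternal` shows that the intended pairs are included.
  Fraternal : V → V → Set
  Fraternal u v = ∃[ i ] ∃[ p ] Contracted G (root i p) u v

  Fraternal? : ∀ u → Decidable (Fraternal u)
  Fraternal? u v = any? λ i → any? λ p → contracted? G (root i p) u v

  Fraternal-sym : ∀ {u v} → Fraternal u v → Fraternal v u
  Fraternal-sym (i , p , r) = i , p , Contracted-sym G r

  -- There are `suc c` colours and `c` parent indices, and each resulting contraction contributes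
  -- `c`.
  Fraternal-sparse : NablaAtMost 1 c G → Sparse (suc c * (c * c)) Fraternal?
  Fraternal-sparse nabla = Sparse-∃ (suc c) (λ i u v → any? λ p → contracted? G (root i p) u v) λ i →
    Sparse-∃ c (λ p → contracted? G (root i p)) λ p →
    contracted-sparse G (root i p) (root-near i p) nabla

  -- Take the colour of `u` and the index of `w` among its parents. The neighbours `w` and `v` of
  -- `u` have other colours and stay fixed, while `u` merges into `w`, turning the edge `uv` into
  -- `wv`.
  parent-fraternal : ∀ {u w v} → w ∈ parents u → Adj G u v → w ≢ v → Fraternal w v
  parent-fraternal {u} {w} {v} w∈ uv w≢v =
    let p , eq = ∈⇒nth (length-out (Adj? G) deg₀ u) w∈
    in λ₀ u , p , contracted w≢v
         (root-fixed p (≡.≢-sym (λ₀-proper (parent⇒Adj w∈)))) (root-fixed p (≡.≢-sym (λ₀-proper uv)))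
         (u , v , root-parent eq , root-fixed p (≡.≢-sym (λ₀-proper uv)) , uv)

-- Labels of a vertex and the suffixes of its ancestry.

baseColours : ℕ → ℕ → ℕ
baseColours c D = suc c * (suc D * ((2 ^ D) ^ suc D * suc (suc D)))

module Labels (G : Graph) {c : ℕ} (layout₀ : Layout c (Adj? G))
              {D : ℕ} (layout₁ : Layout D (Parents.Fraternal? G layout₀)) where

  open Parents G layout₀
  open Layout layout₀ using () renaming (colour to λ₀)
  open Layout layout₁ renaming
    (order to L; unique to L-unique; exhaustive to ∈L; degenerate to deg; colour to λ₁; colour-proper to λ₁-proper)
  open DecMembership {A = Fin (n G)} _≟ᶠ_ using (_∈?_)
  open Refinement {n G} (≡-dec (_≟ᶠ_ {n G}))

  private
    V = Fin (n G)

  λ₁-separates : ∀ {u w v} → w ∈ parents u → Adj G u v → λ₁ w ≡ λ₁ v → w ≡ v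
  λ₁-separates {u} {w} {v} w∈ uv eq with w ≟ᶠ v
  ... | yes w≡v = w≡v
  ... | no w≢v  = contradiction eq (λ₁-proper w≢v (parent-fraternal w∈ uv w≢v))

  ancestry : V → List V
  ancestry v = filter (_∈? parents v) L

  -- Two distinct parents of `v` are both neighbours of `v`, hence fraternal, so the parents form a
  -- clique.
  length-ancestry : ∀ v → length (ancestry v) ≤ suc D
  length-ancestry v = length-filter-clique Fraternal? (_∈? parents v)
    (λ u∈ w∈ → parent-fraternal u∈ (parent⇒Adj w∈)) L-unique deg

  later : V → List V
  later = out Fraternal? L

  -- Distinct parents of v differ in λ₁, so the colour j names at most one of them.
  Hit : V → Fin (suc D) → Fin D → Set
  Hit v j q = ∃[ u ] (u ∈ parents v × λ₁ u ≡ j × ∃[ w ] (nth (later u) q ≡ just w × w ∈ parents v))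

  hit? : ∀ v j q → Dec (Hit v j q)
  hit? v j q = any? λ u → u ∈? parents v ×-dec λ₁ u ≟ᶠ j ×-dec
    any? λ w → ≡-decᵐ _≟ᶠ_ (nth (later u) q) (just w) ×-dec w ∈? parents v

  hits : V → Fin (suc D) → Fin (2 ^ D)
  hits v j = funToFin (bit ∘ hit? v j)

  abstract
    -- The table of `Hit v` packed into one number: for each of the `suc D` colours, a subset of the
    -- `D` later positions.
    code : V → Fin ((2 ^ D) ^ suc D)
    code v = funToFin (hits v)

    code-hit : ∀ {v v′ j q} → code v ≡ code v′ → Hit v j q → Hit v′ j q
    code-hit {v} {v′} {j} {q} eq h = bit-one⁻ (hit? v′ j q) (trans (≡.sym bit≡) (bit-one⁺ (hit? v j q) h))
      where
      bit≡ : bit (hit? v j q) ≡ bit (hit? v′ j q)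
      bit≡ = funToFin-injective (bit ∘ hit? v j) (bit ∘ hit? v′ j) (funToFin-injective (hits v) (hits v′) eq j) q

  -- Since `w` is a later fraternal neighbour of `u`, it is recorded as a hit of `v` under the
  -- colour of `u`. Equal codes give a hit of `v′` by some parent `u′` of that colour; `u` is also a
  -- parent of `v′`, so `u′` is `u` and the vertex hit is `w`.
  code-later : ∀ {v v′ u w} → code v ≡ code v′ → u ∈ parents v → u ∈ parents v′ →
               w ∈ after L u → w ∈ parents v → w ∈ parents v′
  code-later {v} {v′} {u} {w} eq u∈v u∈v′ w∈L w∈v
    with q , nth≡ ← ∈⇒nth (length-out Fraternal? deg u)
           (∈-filter⁺ (Fraternal? u) w∈L
             (parent-fraternal u∈v (parent⇒Adj w∈v) λ { refl → after-irrefl L-unique u w∈L }))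
    with u′ , u′∈v′ , λu′ , w′ , nth≡′ , w′∈v′ ← code-hit eq (u , u∈v , refl , w , nth≡ , w∈v)
    with refl ← λ₁-separates u′∈v′ (parent⇒Adj u∈v′) λu′
    with refl ← just-injective (trans (≡.sym nth≡) nth≡′) = w′∈v′

  lengthColour : V → Fin (suc (suc D))
  lengthColour v = fromℕ< (s≤s (length-ancestry v))

  abstract
    -- `λ₀` provides properness, `λ₁` separates a parent from the other neighbours, and `code` with
    -- the length of the ancestry fixes the suffix and its position. That length ranges from 0 to
    -- `suc D`, whence the factor `suc (suc D)`.
    base : V → Fin (baseColours c D)
    base v = combine (λ₀ v) (combine (λ₁ v) (combine (code v) (lengthColour v)))

    base-injective : ∀ {v w} → base v ≡ base w →
      λ₀ v ≡ λ₀ w × λ₁ v ≡ λ₁ w × code v ≡ code w × length (ancestry v) ≡ length (ancestry w)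
    base-injective {v} {w} eq =
      let eq₀ , eq′  = combine-injective (λ₀ v) _ (λ₀ w) _ eq
          eq₁ , eq″  = combine-injective (λ₁ v) _ (λ₁ w) _ eq′
          eq₂ , eq₃ = combine-injective (code v) _ (code w) _ eq″
      in eq₀ , eq₁ , eq₂ , fromℕ<-injective _ _ _ _ eq₃

  -- The singleton at index 0 makes the first key injective, as `refinement` requires. The suffix
  -- starting at position `t` therefore has index `suc t`.
  key : ℕ → V → List V
  key zero    v = v ∷ []
  key (suc t) v = drop t (ancestry v)

  key-det : ∀ t → key t Determines key (suc t)
  key-det zero    eq = cong ancestry (∷-injectiveˡ eq)
  key-det (suc t) {v} {w} eq =
    trans (drop-suc (ancestry v)) (trans (cong (drop 1) eq) (≡.sym (drop-suc (ancestry w))))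
    where
    drop-suc : ∀ xs → drop (suc t) xs ≡ drop 1 (drop t xs)
    drop-suc xs = trans (cong (λ s → drop s xs) (+-comm 1 t)) (≡.sym (drop-drop t 1 xs))

  position : ∀ {u v} → u ∈ parents v →
    ∃[ t ] (drop t (ancestry v) ≡ u ∷ filter (_∈? parents v) (after L u))
  position {u} {v} u∈ = filter-from (_∈? parents v) u∈ L (∈L u)

  -- A refinement of the labels with odd classes is a strong odd colouring.

  module _ {k} (χ : V → Fin k) (χ-base : χ Determines base)
           (χ-odd : ∀ t → t ≤ suc D → OddClasses (key t) χ) where

    -- Equal codes make the parts of the two ancestries after `u` agree. As the total lengths agree
    -- too, `u` stands at the same position in both.
    same-position : ∀ {u v v′ t} → u ∈ parents v → u ∈ parents v′ → χ v ≡ χ v′ →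
      drop t (ancestry v) ≡ u ∷ filter (_∈? parents v) (after L u) →
      drop t (ancestry v′) ≡ u ∷ filter (_∈? parents v) (after L u)
    same-position {u} {v} {v′} {t} u∈v u∈v′ eq at =
      let _ , _ , code≡ , len≡ = base-injective (χ-base eq)
          t′ , at′ = position u∈v′
          suffix≡ = filter-cong-∈ (_∈? parents v′) (_∈? parents v) (after L u)
                      (code-later (≡.sym code≡) u∈v′ u∈v) (code-later code≡ u∈v u∈v′)
          at″ = trans at′ (cong (u ∷_) suffix≡)
          t≡t′ = +-cancelʳ-≡ _ t t′ (trans (≡.sym (length-drop-∷ t (ancestry v) at))
                   (trans len≡ (length-drop-∷ t′ (ancestry v′) at″)))
      in trans (cong (λ s → drop s (ancestry v′)) t≡t′) at″

    χ-proper : IsProperColouring G χ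
    χ-proper u v uv eq = λ₀-proper uv (proj₁ (base-injective (χ-base eq)))

    nbr? : ∀ u i → Decidable (λ v → Adj G u v × χ v ≡ i)
    nbr? u i v = Adj? G u v ×-dec χ v ≟ᶠ i

    colourCount≡cnt : ∀ u i → colourCount G χ u i ≡ cnt (nbr? u i) (allFin (n G))
    colourCount≡cnt u i = count≡cnt (n G) _ (nbr? u i) to from
      where
      to : ∀ v → adj G u v ∧ ⌊ χ v ≟ᶠ i ⌋ ≡ true → Adj G u v × χ v ≡ i
      to v eq with adj G u v | χ v ≟ᶠ i
      ... | true | yes χv = refl , χv
      from : ∀ v → Adj G u v × χ v ≡ i → adj G u v ∧ ⌊ χ v ≟ᶠ i ⌋ ≡ true
      from v (uv , χv) rewrite uv with χ v ≟ᶠ i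
      ... | yes _  = refl
      ... | no χv≢ = contradiction χv χv≢

    nbrs-odd : ∀ u i → ZeroOrOdd (cnt (nbr? u i) (allFin (n G)))
    nbrs-odd u i with any? (λ w → w ∈? parents u ×-dec χ w ≟ᶠ i)
    -- By `λ₁`, a parent of colour `i` is the only neighbour of that colour, so the count is 1.
    ... | yes (w , w∈ , χw) = inj₂ (0 , cnt-unique (nbr? u i) (allFin⁺ (n G)) (∈-allFin w) (parent⇒Adj w∈ , χw)
            λ (uv , χv) → ≡.sym (λ₁-separates w∈ uv (proj₁ (proj₂ (base-injective (χ-base (trans χw (≡.sym χv))))))))
    ... | no ¬parent with any? (λ v → u ∈? parents v ×-dec χ v ≟ᶠ i)
    ...   | no ¬child = inj₁ (cnt-none (nbr? u i) (allFin (n G)) none)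
      where
      none : ∀ {v} → v ∈ allFin (n G) → ¬ (Adj G u v × χ v ≡ i)
      none _ (uv , χv) with Adj⇒parent uv
      ... | inj₁ v∈ = ¬parent (_ , v∈ , χv)
      ... | inj₂ u∈ = ¬child (_ , u∈ , χv)
    -- Now all neighbours of colour `i` are children of `u`. They are exactly the vertices of colour
    -- `i` whose ancestry has the same suffix from position `t` as that of `v₀`, which is one class
    -- of `key (suc t)`.
    ...   | yes (v₀ , u∈v₀ , χv₀) with t , at ← position u∈v₀ =
      subst ZeroOrOdd (cnt-cong (class? (key (suc t)) χ k₀ i) (nbr? u i) (allFin (n G)) to from)
        (χ-odd (suc t) t<D k₀ i)
      where
      k₀ = u ∷ filter (_∈? parents v₀) (after L u)

      -- The suffix contains `u`, so `t` is less than the length of the ancestry.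
      t<D : suc t ≤ suc D
      t<D = ≤-trans (m<m+n t (s≤s z≤n))
              (≤-trans (≤-reflexive (≡.sym (length-drop-∷ t (ancestry v₀) at))) (length-ancestry v₀))

      -- A suffix beginning with `u` puts `u` among the parents of `v`.
      to : ∀ {v} → drop t (ancestry v) ≡ k₀ × χ v ≡ i → Adj G u v × χ v ≡ i
      to {v} (at-v , χv) = Adj-sym G (parent⇒Adj u∈v) , χv
        where
        u∈v : u ∈ parents v
        u∈v = proj₂ (∈-filter⁻ (_∈? parents v) {xs = L}
                (∈-drop⁻ t (ancestry v) (subst (u ∈_) (≡.sym at-v) (here refl))))

      from : ∀ {v} → Adj G u v × χ v ≡ i → drop t (ancestry v) ≡ k₀ × χ v ≡ i
      from (uv , χv) with Adj⇒parent uv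
      ... | inj₁ v∈ = contradiction (_ , v∈ , χv) ¬parent
      ... | inj₂ u∈ = same-position {t = t} u∈v₀ u∈ (trans χv₀ (≡.sym χv)) at , χv

    strongOdd : IsStrongOddColouring G χ
    strongOdd = χ-proper , λ u i → subst ZeroOrOdd (≡.sym (colourCount≡cnt u i)) (nbrs-odd u i)

-- The bound in terms of depth-1 minors.

strongOddBound : ℕ → ℕ
strongOddBound c = refinedColours (baseColours c D) (suc D)
  -- This is the sparsity constant of `Fraternal?`. An ancestry has at most `suc D` positions, and
  -- each costs one round of refinement.
  where D = suc c * (c * c)

strongOddChromatic≤ : ∀ G c → NablaAtMost 1 c G → StrongOddChromaticAtMost (strongOddBound c) G
strongOddChromatic≤ G c nabla =
  proj₁ refined , strongOdd (proj₁ refined) (proj₁ (proj₂ refined)) (proj₂ (proj₂ refined))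
  where
  layout₀ : Layout c (Adj? G)
  layout₀ = layout (Adj? G) (Adj-sym G) (Adj-sparse G nabla)

  open Parents G layout₀ using (Fraternal?; Fraternal-sym; Fraternal-sparse)

  layout₁ : Layout (suc c * (c * c)) Fraternal?
  layout₁ = layout Fraternal? Fraternal-sym (Fraternal-sparse nabla)

  open Labels G layout₀ layout₁ using (base; key; key-det; strongOdd)
  open Refinement {n G} (≡-dec (_≟ᶠ_ {n G}))

  refined : Σ (Fin (n G) → Fin (strongOddBound c)) λ χ →
            χ Determines base × (∀ t → t ≤ suc (suc c * (c * c)) → OddClasses (key t) χ)
  refined = refinement key ∷-injectiveˡ key-det (suc (suc c * (c * c))) base

theorem1p1 : (𝒞 : Graph → Set) → BoundedExpansion 𝒞 →
    ∃[ c ] (∀ G → 𝒞 G → StrongOddChromaticAtMost c G)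
theorem1p1 𝒞 bounded with c , nabla ← bounded 1 =
  strongOddBound c , λ G G∈𝒞 → strongOddChromatic≤ G c (nabla G G∈𝒞)
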